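{- All instances $(G,D,\Delta)$ of DiTTR with $\Delta=2$ are feasible.
   Context: All graphs are finite. A $\Delta$-periodic labeling of a directed graph $G=(V,E)$ is a map $\lambda:E\to\{0,1,\dots,\Delta-1\}$; edge $e$ is then active exactly at the times $\lambda(e)+i\Delta$, $i\in\mathbb{N}_0$. A temporal $s$-$z$-path is a sequence $(v_{i-1},v_i,t_i)_{i=1}^{\ell}$ with $v_0=s$, $v_\ell=z$, pairwise distinct vertices $v_0,\dots,v_\ell$, $(v_{i-1},v_i)\in E$ active at time $t_i$ for every $i$, and $t_1<t_2<\dots<t_\ell$ (strictly increasing). Its duration is $t_\ell+1-t_1$. A fastest temporal path is one of minimum duration. $\hat d(u,v)$ is the distance from $u$ to $v$ in the static graph $G$ (all edges have unit length). A bidirected tree is the directed graph obtained from an undirected tree by replacing each edge $\{u,v\}$ by the two directed edges $(u,v),(v,u)$ (which may get different labels). An instance of DiTTR is a triple $(G,D,\Delta)$ with $G=(V,E)$ a bidirected tree, $D$ a matrix indexed by $V\times V$ with entries positive integers or $\infty$ (no restriction) such that $D_{u,v}\ge \hat d(u,v)$ for all $u,v$, and $\Delta$ a positive integer. It is feasible (realizable) if there is a $\Delta$-periodic labeling $\lambda$ of $E$ such that, for all $u,v\in V$, the duration of a fastest temporal path from $u$ to $v$ is at most $D_{u,v}$. Diagonal entries of $D$ play no role; all conditions on $D$ are for distinct vertices. -}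

module Defs where

open import Data.Fin using (Fin; toℕ)
open import Data.List using (List; []; _∷_)
open import Data.List.Relation.Unary.Linked using (Linked)
open import Data.List.Relation.Unary.Unique.Propositional using (Unique)
open import Data.Nat using (ℕ; suc; _+_; _*_; _∸_; _≤_; _<_; NonZero)
open import Data.Product using (Σ; ∃-syntax; _×_; _,_)
open import Level using (0ℓ)
open import Relation.Binary.Construct.Add.Supremum.NonStrict _≤_ using (_≤⁺_)
open import Relation.Binary.Construct.Closure.ReflexiveTransitive using (Star; ε; _◅_)
open import Relation.Binary.Core using (Rel)
open import Relation.Binary.Definitions using (Decidable; Irrelevant; Symmetric)
open import Relation.Binary.PropositionalEquality using (_≡_; _≢_)
open import Relation.Nullary using (¬_)
open import Relation.Nullary.Construct.Add.Supremum using (_⁺; ⊤⁺; [_])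

-- ⊤⁺ is ∞, and _≤⁺_ is the usual order.
ℕ∞ : Set
ℕ∞ = ℕ ⁺

IsMinimiser : {A : Set} → (A → ℕ) → A → Set
IsMinimiser f a = ∀ b → f a ≤ f b

-- The minimum of f over A equals the given value, the minimum over an
-- empty A being ∞.
IsMinimum : {A : Set} → (A → ℕ) → ℕ∞ → Set
IsMinimum f [ m ]   = ∃[ a ] IsMinimiser f a × f a ≡ m
IsMinimum {A} f ⊤⁺ = ¬ A

module _ {V : Set} {R : Rel V 0ℓ} where

  vertices : ∀ {u v} → Star R u v → List V
  vertices {u} ε       = u ∷ []
  vertices {u} (_ ◅ w) = u ∷ vertices w

  length : ∀ {u v} → Star R u v → ℕ
  length ε       = 0
  length (_ ◅ w) = suc (length w)

Path : {V : Set} → Rel V 0ℓ → V → V → Set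
Path R u v = Σ (Star R u v) λ w → Unique (vertices w)

pathLength : ∀ {V : Set} {R : Rel V 0ℓ} {u v} → Path R u v → ℕ
pathLength (w , _) = length w

-- Irrelevance of the edge relation makes the edge set a subset of V × V,
-- so that a function on edges depends only on the pair of endpoints.
record Graph (n : ℕ) : Set₁ where
  field
    Adj            : Rel (Fin n) 0ℓ
    Adj?           : Decidable Adj
    Adj-irrelevant : Irrelevant Adj
    Adj-sym        : Symmetric Adj
    loopless       : ∀ {v} → ¬ Adj v v

record Digraph (n : ℕ) : Set₁ where
  field
    Edge            : Rel (Fin n) 0ℓ
    Edge?           : Decidable Edge
    Edge-irrelevant : Irrelevant Edge

module _ {n : ℕ} (T : Graph n) where
  open Graph T

  Connected : Set
  Connected = ∀ u v → Path Adj u v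

  -- A cycle is a path with at least three vertices together with an edge
  -- from its end back to its start.
  Cycle : Set
  Cycle = ∃[ u ] ∃[ v ] Σ (Path Adj u v) λ p → 2 ≤ pathLength p × Adj v u

  record IsTree : Set where
    field
      nonEmpty  : NonZero n
      connected : Connected
      acyclic   : ¬ Cycle

  bidirected : Digraph n
  bidirected = record
    { Edge            = Adj
    ; Edge?           = Adj?
    ; Edge-irrelevant = Adj-irrelevant
    }

lastTime : ℕ → List ℕ → ℕ
lastTime t []        = t
lastTime t (t′ ∷ ts) = lastTime t′ ts

-- Length of the time interval spanned by an increasing sequence of times;
-- the empty sequence only occurs for paths from a vertex to itself.
span : List ℕ → ℕ
span []       = 0
span (t ∷ ts) = (lastTime t ts + 1) ∸ t

module _ {n : ℕ} (G : Digraph n) where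
  open Digraph G

  IsDistance : Fin n → Fin n → ℕ∞ → Set
  IsDistance u v = IsMinimum (pathLength {R = Edge} {u} {v})

  Labeling : ℕ → Set
  Labeling Δ = ∀ u v → Edge u v → Fin Δ

  module _ {Δ : ℕ} (label : Labeling Δ) where

    ActiveAt : ∀ {u v} → Edge u v → ℕ → Set
    ActiveAt {u} {v} e t = ∃[ i ] t ≡ toℕ (label u v e) + i * Δ

    record TimeEdge (u v : Fin n) : Set where
      field
        edge   : Edge u v
        time   : ℕ
        active : ActiveAt edge time

    times : ∀ {u v} → Star TimeEdge u v → List ℕ
    times ε       = []
    times (e ◅ w) = TimeEdge.time e ∷ times w

    TemporalPath : Fin n → Fin n → Set
    TemporalPath s z =
      Σ (Star TimeEdge s z) λ w → Unique (vertices w) × Linked _<_ (times w)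

    duration : ∀ {s z} → TemporalPath s z → ℕ
    duration (w , _) = span (times w)

    IsFastest : ∀ {s z} → TemporalPath s z → Set
    IsFastest = IsMinimiser duration

    -- The value [ d ] is that of some p with IsFastest p; it is ∞ when there
    -- is no temporal path.
    IsFastestDuration : Fin n → Fin n → ℕ∞ → Set
    IsFastestDuration s z = IsMinimum (duration {s} {z})

record DiTTR : Set₁ where
  field
    {n}    : ℕ
    tree   : Graph n
    isTree : IsTree tree
    D      : Fin n → Fin n → ℕ∞
    Δ      : ℕ
    Δ-pos  : NonZero Δ

  G : Digraph n
  G = bidirected tree

  field
    D-pos : ∀ {u v} → u ≢ v → [ 1 ] ≤⁺ D u v
    D≥d̂  : ∀ {u v} → u ≢ v → ∀ d → IsDistance G u v d → d ≤⁺ D u v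

Feasible : DiTTR → Set
Feasible I =
  Σ (Labeling G Δ) λ label →
    ∀ {u v} → u ≢ v → ∃[ d ] IsFastestDuration G label u v d × d ≤⁺ D u v
  where open DiTTR I

-- Paths in a tree are unique, so the parity of the distance to a fixed root is
-- a proper 2-colouring. Give every edge (u , v) the colour of its tail u. Along
-- any path consecutive edges then carry different labels, so the path can be
-- traversed without waiting, and its duration is the static distance, which
-- is at most D u v.

{-# OPTIONS --safe #-}
module Submission where

open import Defs
open import Data.Fin using (Fin; zero; suc; toℕ; fromℕ<; opposite)
open import Data.Fin.Properties using (_≟_; opposite-involutive)
open import Data.List as List using ([]; _∷_)
open import Data.List.Membership.Propositional using (_∈_; _∉_)
open import Data.List.Relation.Binary.Subset.Propositional using (_⊆_)
open import Data.List.Relation.Binary.Subset.Propositional.Properties using (∷⁺ʳ)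
open import Data.List.Relation.Unary.All as All using (All; []; _∷_)
open import Data.List.Relation.Unary.All.Properties using (¬Any⇒All¬; anti-mono)
open import Data.List.Relation.Unary.AllPairs using ([]; _∷_)
open import Data.List.Relation.Unary.Any using (here; there; any?)
open import Data.List.Relation.Unary.Linked using (Linked; []; [-]; _∷_)
open import Data.List.Relation.Unary.Unique.Propositional using (Unique)
open import Data.Nat using (ℕ; zero; suc; _+_; _*_; _∸_; _≤_; _<_; z≤n; s≤s; >-nonZero⁻¹)
open import Data.Nat.Properties using (≤-refl; ≤-reflexive; m≤n⇒m≤1+n; <-asym; n<1+n; +-suc; +-comm; +-assoc; +-identityʳ; +-monoˡ-≤; m+n∸m≡n; ∸-monoˡ-≤; module ≤-Reasoning)
open import Data.Product using (Σ; ∃-syntax; _×_; _,_; proj₁; proj₂)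
open import Data.Sum using (_⊎_; inj₁; inj₂)
open import Function using (_∘_)
open import Level using (0ℓ)
open import Relation.Binary.Construct.Closure.ReflexiveTransitive using (Star; ε; _◅_; _◅◅_; map; revApp; reverse)
open import Relation.Binary.Core using (Rel)
open import Relation.Binary.Definitions using (DecidableEquality; Symmetric)
open import Relation.Binary.PropositionalEquality using (_≡_; _≢_; refl; sym; trans; cong; subst)
open import Relation.Nullary using (yes; no; contradiction)
open import Relation.Nullary.Construct.Add.Supremum using ([_])
open import Relation.Unary using (Pred)

-- Walks: avoided vertices, suffixes and loop erasure.

module _ {V : Set} {R : Rel V 0ℓ} where

  length-pos : ∀ {u v} → u ≢ v → (w : Star R u v) → 1 ≤ length w
  length-pos u≢u ε       = contradiction refl u≢u
  length-pos _   (_ ◅ _) = s≤s z≤n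

  end∈vertices : ∀ {u v} (w : Star R u v) → v ∈ vertices w
  end∈vertices ε       = here refl
  end∈vertices (_ ◅ w) = there (end∈vertices w)

  module _ {P : Pred V 0ℓ} where

    All-start : ∀ {u v} (w : Star R u v) → All P (vertices w) → P u
    All-start ε       (pu ∷ _) = pu
    All-start (_ ◅ _) (pu ∷ _) = pu

    All-◅◅ : ∀ {u v x} (p : Star R u v) {q : Star R v x} →
             All P (vertices p) → All P (vertices q) → All P (vertices (p ◅◅ q))
    All-◅◅ ε       _          qs = qs
    All-◅◅ (_ ◅ p) (pu ∷ ps) qs = pu ∷ All-◅◅ p ps qs

    All-revApp : ∀ (R-sym : Symmetric R) {u v x} (p : Star R u v) {q : Star R u x} →
                 All P (vertices p) → All P (vertices q) → All P (vertices (revApp R-sym p q))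
    All-revApp R-sym ε       _         qs = qs
    -- The accumulator already begins at the dropped vertex, so the only vertex added to it is the
    -- start of the remaining `p`.
    All-revApp R-sym (_ ◅ p) (_ ∷ ps) qs =
      All-revApp R-sym p ps (All-start p ps ∷ qs)

  -- The inclusion serves loop erasure, the length bound the comparison of heights.
  suffixFrom : ∀ {u v x} (w : Star R u v) → Unique (vertices w) → x ∈ vertices w →
               Σ (Path R x v) λ p → vertices (proj₁ p) ⊆ vertices w × pathLength p ≤ length w
  suffixFrom ε       uw       (here refl) = (ε , uw) , (λ y∈ → y∈) , ≤-refl
  suffixFrom (e ◅ w) uw       (here refl) = (e ◅ w , uw) , (λ y∈ → y∈) , ≤-refl
  suffixFrom (e ◅ w) (_ ∷ uw) (there x∈w) =
    let p , p⊆w , p≤w = suffixFrom w uw x∈w in p , there ∘ p⊆w , m≤n⇒m≤1+n p≤w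

  -- Loops are erased in the tail first; if `u` recurs there, the suffix from that occurrence cuts
  -- off the loop. Thanks to the inclusion, a vertex avoided by the walk is avoided by the path.
  loopErase : DecidableEquality V → ∀ {u v} (w : Star R u v) →
              Σ (Path R u v) λ p → vertices (proj₁ p) ⊆ vertices w
  loopErase _≟V_ ε           = (ε , [] ∷ []) , λ y∈ → y∈
  loopErase _≟V_ {u} (e ◅ w) with loopErase _≟V_ w
  ... | (p , up) , p⊆w with any? (u ≟V_) (vertices p)
  ...   | yes u∈p = let q , q⊆p , _ = suffixFrom p up u∈p in q , there ∘ p⊆w ∘ q⊆p
  ...   | no  u∉p = (e ◅ p , ¬Any⇒All¬ _ u∉p ∷ up) , ∷⁺ʳ u p⊆w

module _ {V : Set} {R S : Rel V 0ℓ} (f : ∀ {u v} → R u v → S u v) where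

  vertices-map : ∀ {u v} (w : Star R u v) → vertices (map f w) ≡ vertices w
  vertices-map ε       = refl
  vertices-map (_ ◅ w) = cong (_ ∷_) (vertices-map w)

  length-map : ∀ {u v} (w : Star R u v) → length (map f w) ≡ length w
  length-map ε       = refl
  length-map (_ ◅ w) = cong suc (length-map w)

-- Lower bound on the duration of a temporal path.

lastTime-≥ : ∀ t ts → Linked _<_ (t ∷ ts) → t + List.length ts ≤ lastTime t ts
lastTime-≥ t []        _          = ≤-reflexive (+-identityʳ t)
lastTime-≥ t (t′ ∷ ts) (t<t′ ∷ l) = begin
  t + suc (List.length ts)  ≡⟨ +-suc t _ ⟩
  suc t + List.length ts    ≤⟨ +-monoˡ-≤ _ t<t′ ⟩
  t′ + List.length ts       ≤⟨ lastTime-≥ t′ ts l ⟩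
  lastTime t′ ts            ∎
  where open ≤-Reasoning

[t+m+1]∸t≡1+m : ∀ t m → (t + m + 1) ∸ t ≡ suc m
[t+m+1]∸t≡1+m t m = trans (cong (_∸ t) (trans (+-assoc t m 1) (cong (t +_) (+-comm m 1)))) (m+n∸m≡n t (suc m))

-- Times are integers, so a strict increase adds at least one per edge.
span-≥ : ∀ ts → Linked _<_ ts → List.length ts ≤ span ts
span-≥ []       _ = z≤n
span-≥ (t ∷ ts) l = begin
  suc (List.length ts)            ≡⟨ [t+m+1]∸t≡1+m t (List.length ts) ⟨
  (t + List.length ts + 1) ∸ t    ≤⟨ ∸-monoˡ-≤ t (+-monoˡ-≤ 1 (lastTime-≥ t ts l)) ⟩
  (lastTime t ts + 1) ∸ t         ∎
  where open ≤-Reasoning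

module _ {n Δ : ℕ} (G : Digraph n) (label : Labeling G Δ) where

  length-times : ∀ {u v} (w : Star (TimeEdge G label) u v) → List.length (times G label w) ≡ length w
  length-times ε       = refl
  length-times (_ ◅ w) = cong suc (length-times w)

  length≤span : ∀ {u v} (w : Star (TimeEdge G label) u v) →
                Linked _<_ (times G label w) → length w ≤ span (times G label w)
  length≤span w l = subst (_≤ span (times G label w)) (length-times w) (span-≥ _ l)

parity : ℕ → Fin 2
parity zero    = zero
parity (suc n) = opposite (parity n)

opposite-parity : ∀ {m n} → m ≡ suc n ⊎ n ≡ suc m → parity n ≡ opposite (parity m)
opposite-parity {n = n} (inj₁ refl) = sym (opposite-involutive (parity n))
opposite-parity         (inj₂ refl) = refl

module Tree {n : ℕ} (T : Graph n) (isTree : IsTree T) where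
  open Graph T
  open IsTree isTree

  -- If the paths leave u through different neighbours a and b, then they yield
  -- a walk from a to b avoiding u, whose loop erasure closes to a cycle
  -- through u.
  simple-length-unique : ∀ {u v} (p q : Star Adj u v) → Unique (vertices p) → Unique (vertices q) →
                         length p ≡ length q
  simple-length-unique ε       ε       _         _         = refl
  simple-length-unique ε       (_ ◅ q) _         (u∉q ∷ _) =
    contradiction refl (All.lookup u∉q (end∈vertices q))
  simple-length-unique (_ ◅ p) ε       (u∉p ∷ _) _         =
    contradiction refl (All.lookup u∉p (end∈vertices p))
  simple-length-unique {u} (_◅_ {j = a} e p) (_◅_ {j = b} f q) (u∉p ∷ up) (u∉q ∷ uq) with a ≟ b
  ... | yes refl = cong suc (simple-length-unique p q up uq)
  ... | no a≢b with loopErase _≟_ (p ◅◅ reverse Adj-sym q)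
  ...   | (r , ur) , r⊆w =
    contradiction (u , b , (e ◅ r , u∉r ∷ ur) , s≤s (length-pos a≢b r) , Adj-sym f) acyclic
    where
    u∉r : All (u ≢_) (vertices r)
    u∉r = anti-mono r⊆w (All-◅◅ p u∉p (All-revApp Adj-sym q u∉q (All-start q u∉q ∷ [])))

  pathLength-unique : ∀ {u v} (p q : Path Adj u v) → pathLength p ≡ pathLength q
  pathLength-unique (p , up) (q , uq) = simple-length-unique p q up uq

  path-minimiser : ∀ {u v} (p : Path Adj u v) → IsMinimiser pathLength p
  path-minimiser p q = ≤-reflexive (pathLength-unique p q)

  -- Heights and their change along an edge.

  root : Fin n
  root = fromℕ< (>-nonZero⁻¹ n {{nonEmpty}})

  height : Fin n → ℕ
  height v = pathLength (connected v root)

  -- The suffix of `p` from `v` omits at least the first edge, and by uniqueness its length is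
  -- `height v`.
  height-∈ : ∀ {u v} (p : Star Adj u root) → Unique (vertices p) → u ≢ v → v ∈ vertices p → height v < length p
  height-∈         ε       _        u≢v (here v≡u)  = contradiction (sym v≡u) u≢v
  height-∈         (_ ◅ _) _        u≢v (here v≡u)  = contradiction (sym v≡u) u≢v
  height-∈ {v = v} (_ ◅ p) (_ ∷ up) _   (there v∈p) =
    let q , _ , q≤p = suffixFrom p up v∈p
    in s≤s (subst (_≤ length p) (pathLength-unique q (connected v root)) q≤p)

  -- Prepending `v` to the path from `u` keeps it simple, so uniqueness of path lengths applies.
  height-∉ : ∀ {u v} → Adj v u → v ∉ vertices (proj₁ (connected u root)) → height v ≡ suc (height u)
  height-∉ {u} {v} e v∉p = pathLength-unique (connected v root)
    (e ◅ proj₁ (connected u root) , ¬Any⇒All¬ _ v∉p ∷ proj₂ (connected u root))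

  height-Adj : ∀ {u v} → Adj u v → height u ≡ suc (height v) ⊎ height v ≡ suc (height u)
  height-Adj {u} {v} e
    with any? (u ≟_) (vertices (proj₁ (connected v root)))
       | any? (v ≟_) (vertices (proj₁ (connected u root)))
  ... | no u∉q  | _       = inj₁ (height-∉ e u∉q)
  ... | yes _   | no v∉p  = inj₂ (height-∉ (Adj-sym e) v∉p)
  -- If each endpoint lay on the other's path to the root, each height would be strictly below the
  -- other.
  ... | yes u∈q | yes v∈p = contradiction
    (height-∈ _ (proj₂ (connected v root)) (u≢v ∘ sym) u∈q)
    (<-asym (height-∈ _ (proj₂ (connected u root)) u≢v v∈p))
    where
    u≢v : u ≢ v
    u≢v refl = loopless e

  -- The labeling and travel without waiting.

  colour : Fin n → Fin 2
  colour v = parity (height v)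

  colour-Adj : ∀ {u v} → Adj u v → colour v ≡ opposite (colour u)
  colour-Adj e = opposite-parity (height-Adj e)

  tailLabel : Labeling (bidirected T) 2
  tailLabel u _ _ = colour u

  -- This is `ActiveAt` for `tailLabel` without the edge: it makes sense at a vertex before the next
  -- edge is chosen, and also at the end of a walk.
  Departs : Fin n → ℕ → Set
  Departs u t = ∃[ i ] t ≡ toℕ (colour u) + i * 2

  Departs-suc : ∀ {u v t} → Adj u v → Departs u t → Departs v (suc t)
  Departs-suc {u} {v} e (i , refl) rewrite colour-Adj e with colour u
  ... | zero     = i , refl
  -- From colour 1 to colour 0 the departure passes into the next period: `suc (1 + i * 2)` is
  -- `suc i * 2`.
  ... | suc zero = suc i , refl

  noWait : ∀ {u v t} → Star Adj u v → Departs u t → Star (TimeEdge (bidirected T) tailLabel) u v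
  noWait         ε       _ = ε
  noWait {t = t} (e ◅ w) d = record { edge = e ; time = t ; active = d } ◅ noWait w (Departs-suc e d)

  vertices-noWait : ∀ {u v t} (w : Star Adj u v) (d : Departs u t) → vertices (noWait w d) ≡ vertices w
  vertices-noWait ε       _ = refl
  vertices-noWait (e ◅ w) d = cong (_ ∷_) (vertices-noWait w (Departs-suc e d))

  times-noWait-increasing : ∀ {u v t} (w : Star Adj u v) (d : Departs u t) →
                            Linked _<_ (times _ _ (noWait w d))
  times-noWait-increasing ε           _ = []
  times-noWait-increasing (_ ◅ ε)     _ = [-]
  times-noWait-increasing (e ◅ f ◅ w) d =
    n<1+n _ ∷ times-noWait-increasing (f ◅ w) (Departs-suc e d)

  -- Here `t` is the time of the edge just before `w`, hence the departure at `suc t`; it is also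
  -- the default when `w` is empty.
  lastTime-noWait : ∀ {u v} t (w : Star Adj u v) (d : Departs u (suc t)) →
                    lastTime t (times _ _ (noWait w d)) ≡ t + length w
  lastTime-noWait t ε       _ = sym (+-identityʳ t)
  lastTime-noWait t (e ◅ w) d =
    trans (lastTime-noWait (suc t) w (Departs-suc e d)) (sym (+-suc t (length w)))

  span-noWait : ∀ {u v t} (w : Star Adj u v) (d : Departs u t) →
                span (times _ _ (noWait w d)) ≡ length w
  span-noWait         ε       _ = refl
  span-noWait {t = t} (e ◅ w) d =
    trans (cong (λ l → (l + 1) ∸ t) (lastTime-noWait t w (Departs-suc e d)))
          ([t+m+1]∸t≡1+m t (length w))

  -- Fastest durations equal static distances.

  distance : ∀ u v → IsDistance (bidirected T) u v [ pathLength (connected u v) ]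
  distance u v = connected u v , path-minimiser (connected u v) , refl

  fastest≡distance : ∀ u v → IsFastestDuration (bidirected T) tailLabel u v [ pathLength (connected u v) ]
  fastest≡distance u v = p , p-fastest , p-span
    where
    w = proj₁ (connected u v)

    -- The journey starts at the first time at which the edges out of `u` are active.
    d : Departs u (toℕ (colour u))
    d = 0 , sym (+-identityʳ _)

    p : TemporalPath (bidirected T) tailLabel u v
    p = noWait w d
      , subst Unique (sym (vertices-noWait w d)) (proj₂ (connected u v))
      , times-noWait-increasing w d

    p-span : duration (bidirected T) tailLabel p ≡ length w
    p-span = span-noWait w d

    p-fastest : IsFastest (bidirected T) tailLabel p
    -- Forgetting the times of `q` leaves a static path, which has as many edges as `w`; `q` spends
    -- at least one time unit on each.
    p-fastest (q , uq , lq) = begin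
      span (times _ _ (noWait w d))  ≡⟨ p-span ⟩
      length w                       ≡⟨ pathLength-unique (connected u v)
                                          (q′ , subst Unique (sym (vertices-map edge q)) uq) ⟩
      length q′                      ≡⟨ length-map edge q ⟩
      length q                       ≤⟨ length≤span (bidirected T) tailLabel q lq ⟩
      span (times _ _ q)             ∎
      where
      open ≤-Reasoning
      open TimeEdge using (edge)
      q′ = map edge q

corollary8 : (I : DiTTR) → DiTTR.Δ I ≡ 2 → Feasible I
corollary8 record { tree = T ; isTree = isTree ; D≥d̂ = D≥d̂ } refl =
  -- Both underscores are the same value, at once the fastest duration and the static distance, so
  -- the bound on `D` applies directly.
  tailLabel , λ {u} {v} u≢v → _ , fastest≡distance u v , D≥d̂ u≢v _ (distance u v)
  where open Tree T isTree
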